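{- For every formula $A$ of $\mathrm{SN}$: $A$ is true at both worlds $1$ and $2$ of every $\mathrm{SN}$-model if and only if $\mathrm{SN}\vdash A$.
   Context: Formulas of $\mathrm{SN}$ are built from propositional atoms $p$, constants $\top,\bot$ and a propositional constant $t$, using $\neg,\wedge,\vee,\to$ and a unary connective $N$ (applicable to any formula, iterable). Proof system: $\mathrm{SN}\vdash A$ is generated by all classical tautologies; axioms (K) $N(A\wedge B)\leftrightarrow NA\vee NB$; (F) $\neg NA\leftrightarrow N\neg A$; (C) $A\to NNA$; (A) $t\to(p\to N\neg p)$ for atoms $p$; (T) $t\leftrightarrow Nt$; rules modus ponens and (N): from $A$ infer $N\neg A$. Semantics: an $\mathrm{SN}$-model is $M=(\{1,2\},v)$ where $v$ assigns to each atom $p$ a subset $v(p)\subseteq\{1,2\}$ such that $1\in v(p)$ implies $2\in v(p)$. Truth at $m\in\{1,2\}$: $m\vDash p$ iff $m\in v(p)$; $m\vDash\top$; $m\nvDash\bot$; $m\vDash t$ iff $m=1$; classical clauses for $\neg,\wedge,\vee,\to$ at each world; $1\vDash NA$ iff $2\nvDash A$, and $2\vDash NA$ iff $1\nvDash A$. -}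

module Defs where

import Data.Bool as Bool
open Bool using (Bool; true; false)
open import Data.Empty using (⊥)
open import Data.Fin using (Fin; zero; suc)
open import Data.Fin.Subset using (Subset; _∈_)
open import Data.Product using (_×_)
open import Data.Sum using (_⊎_)
open import Data.Unit using (⊤)
open import Relation.Binary.PropositionalEquality using (_≡_)
open import Relation.Nullary using (¬_)

infix  9 ~_
infixr 7 _∧_
infixr 6 _∨_
infixr 5 _⊃_
infix  4 _⟺_

data Formula (Atom : Set) : Set where
  atom        : Atom → Formula Atom
  ⊤′ ⊥′ t     : Formula Atom
  ~_          : Formula Atom → Formula Atom
  _∧_ _∨_ _⊃_ : Formula Atom → Formula Atom → Formula Atom
  N           : Formula Atom → Formula Atom

_⟺_ : {Atom : Set} → Formula Atom → Formula Atom → Formula Atom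
A ⟺ B = (A ⊃ B) ∧ (B ⊃ A)

-- Truth-table value of a formula of the full language. Atoms, t and formulas
-- N A have no classical structure, so e assigns them arbitrary values; e is
-- never consulted on any other formula.
eval : {Atom : Set} → (Formula Atom → Bool) → Formula Atom → Bool
eval e (atom p) = e (atom p)
eval e ⊤′       = true
eval e ⊥′       = false
eval e t        = e t
eval e (~ A)    = Bool.not (eval e A)
eval e (A ∧ B)  = eval e A Bool.∧ eval e B
eval e (A ∨ B)  = eval e A Bool.∨ eval e B
eval e (A ⊃ B)  = Bool.not (eval e A) Bool.∨ eval e B
eval e (N A)    = e (N A)

Tautology : {Atom : Set} → Formula Atom → Set
Tautology {Atom} A = (e : Formula Atom → Bool) → eval e A ≡ true

infix 3 SN⊢_

data SN⊢_ {Atom : Set} : Formula Atom → Set where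
  taut : ∀ {A} → Tautology A → SN⊢ A
  axK  : ∀ A B → SN⊢ N (A ∧ B) ⟺ N A ∨ N B
  axF  : ∀ A → SN⊢ ~ N A ⟺ N (~ A)
  axC  : ∀ A → SN⊢ A ⊃ N (N A)
  axA  : ∀ p → SN⊢ t ⊃ (atom p ⊃ N (~ atom p))
  axT  : SN⊢ t ⟺ N t
  mp   : ∀ {A B} → SN⊢ A ⊃ B → SN⊢ A → SN⊢ B
  rN   : ∀ {A} → SN⊢ A → SN⊢ N (~ A)

World : Set
World = Fin 2

-- The worlds called 1 and 2.
pattern w₁ = zero
pattern w₂ = suc zero

other : World → World
other w₁ = w₂
other w₂ = w₁

record Model (Atom : Set) : Set where
  field
    v          : Atom → Subset 2
    persistent : ∀ p → w₁ ∈ v p → w₂ ∈ v p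

infix 3 _,_⊨_

_,_⊨_ : {Atom : Set} → Model Atom → World → Formula Atom → Set
M , m ⊨ atom p  = m ∈ Model.v M p
M , m ⊨ ⊤′      = ⊤
M , m ⊨ ⊥′      = ⊥
M , m ⊨ t       = m ≡ w₁
M , m ⊨ ~ A     = ¬ (M , m ⊨ A)
M , m ⊨ (A ∧ B) = (M , m ⊨ A) × (M , m ⊨ B)
M , m ⊨ (A ∨ B) = (M , m ⊨ A) ⊎ (M , m ⊨ B)
M , m ⊨ (A ⊃ B) = (M , m ⊨ A) → (M , m ⊨ B)
M , m ⊨ N A     = ¬ (M , other m ⊨ A)

{-# OPTIONS --safe #-}

-- Over SN, negation, ∧ and t commute with N in the way the two-world semantics
-- prescribes, and NN is the identity. Hence a truth assignment e respecting
-- finitely many theorems of SN behaves on A and N A like a two-world model: the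
-- current world is 1 or 2 according to e t, an atom p has the value e p there
-- and the value ¬ e (N p) at the other world. Axiom (A), together with its
-- image under rule (N), makes this model persistent. If A is valid, then A is
-- a tautological consequence of these finitely many theorems.
module Submission where

open import Defs
open import Data.Bool.Base using (Bool; true; false; not; if_then_else_)
  renaming (_∧_ to _∧ᵇ_; _∨_ to _∨ᵇ_)
open import Data.Bool.Properties using (not-involutive)
open import Data.Fin.Properties using (_≟_)
open import Data.Fin.Subset using (Subset; _∈_)
open import Data.Fin.Subset.Properties using (_∈?_)
open import Data.Product using (_×_; _,_; ∃-syntax; proj₁; proj₂)
open import Data.Vec.Base using (_∷_; []; here; there)
open import Function.Bundles using (_⇔_; mk⇔)
open import Relation.Binary.Definitions using (DecidableEquality)
open import Relation.Binary.PropositionalEquality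
  using (_≡_; refl; sym; trans; cong; cong₂)
open import Relation.Nullary using (Dec; yes; no; does)
open import Relation.Nullary.Decidable
  using (¬?; _×-dec_; _⊎-dec_; _→-dec_; dec-true)

private variable
  Atom : Set
  A B : Formula Atom

-- Boolean identities

_⇒ᵇ_ _⇔ᵇ_ : Bool → Bool → Bool
a ⇒ᵇ b = not a ∨ᵇ b
a ⇔ᵇ b = (a ⇒ᵇ b) ∧ᵇ (b ⇒ᵇ a)

⇔ᵇ-complete : ∀ {a b} → a ≡ b → a ⇔ᵇ b ≡ true
⇔ᵇ-complete {true}  refl = refl
⇔ᵇ-complete {false} refl = refl

⇔ᵇ-sound : ∀ a b → a ⇔ᵇ b ≡ true → a ≡ b
⇔ᵇ-sound true  true  _ = refl
⇔ᵇ-sound false false _ = refl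

⇒ᵇ-refl : ∀ a → a ⇒ᵇ a ≡ true
⇒ᵇ-refl true  = refl
⇒ᵇ-refl false = refl

⇒ᵇ-elim : ∀ {a b} → a ⇒ᵇ b ≡ true → a ≡ true → b ≡ true
⇒ᵇ-elim h refl = h

⇒ᵇ-antisym : ∀ a b → a ⇒ᵇ b ≡ true → b ⇒ᵇ a ≡ true → a ≡ b
⇒ᵇ-antisym true  true  _ _ = refl
⇒ᵇ-antisym false false _ _ = refl

not-∧ : ∀ a b → not (a ∧ᵇ b) ≡ not a ∨ᵇ not b
not-∧ true  b = refl
not-∧ false b = refl

not-∨ : ∀ a b → not (a ∨ᵇ b) ≡ not a ∧ᵇ not b
not-∨ true  b = refl
not-∨ false b = refl

not-≡ : ∀ {a b c} → a ≡ not b → a ≡ c → b ≡ not c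
not-≡ eq refl = trans (sym (not-involutive _)) (cong not (sym eq))

-- Soundness

-- The `does` of each decision computes to the matching Boolean connective, so most cases about
-- `value` hold by computation.
sat? : (M : Model Atom) (m : World) (A : Formula Atom) → Dec (M , m ⊨ A)
sat? M m (atom p) = m ∈? Model.v M p
sat? M m ⊤′       = yes _
sat? M m ⊥′       = no λ ()
sat? M m t        = m ≟ w₁
sat? M m (~ A)    = ¬? (sat? M m A)
sat? M m (A ∧ B)  = sat? M m A ×-dec sat? M m B
sat? M m (A ∨ B)  = sat? M m A ⊎-dec sat? M m B
sat? M m (A ⊃ B)  = sat? M m A →-dec sat? M m B
sat? M m (N A)    = ¬? (sat? M (other m) A)

value : Model Atom → World → Formula Atom → Bool
value M m A = does (sat? M m A)

-- A world acts as a truth assignment that reads `N A` as a letter, which makes tautologies true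
-- there.
eval-value : ∀ (M : Model Atom) m A → eval (value M m) A ≡ value M m A
eval-value M m (atom p) = refl
eval-value M m ⊤′       = refl
eval-value M m ⊥′       = refl
eval-value M m t        = refl
eval-value M m (~ A)    = cong not (eval-value M m A)
eval-value M m (A ∧ B)  = cong₂ _∧ᵇ_ (eval-value M m A) (eval-value M m B)
eval-value M m (A ∨ B)  = cong₂ _∨ᵇ_ (eval-value M m A) (eval-value M m B)
eval-value M m (A ⊃ B)  = cong₂ _⇒ᵇ_ (eval-value M m A) (eval-value M m B)
eval-value M m (N A)    = refl

value-persistent : ∀ (M : Model Atom) p →
  value M w₁ (atom p) ⇒ᵇ value M w₂ (atom p) ≡ true
value-persistent M p with Model.v M p | Model.persistent M p
... | false ∷ _     ∷ [] | _ = refl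
... | true  ∷ true  ∷ [] | _ = refl
... | true  ∷ false ∷ [] | h with h here
...   | there ()

-- Both worlds are treated at once because rule (N) uses its premise at the other world.
soundness : SN⊢ A → ∀ M m → value M m A ≡ true
soundness (taut {A} h) M m = trans (sym (eval-value M m A)) (h (value M m))
soundness (axK A B) M m = ⇔ᵇ-complete (not-∧ (value M (other m) A) _)
soundness (axF A) M m = ⇔ᵇ-complete {not (not (value M (other m) A))} refl
-- Splitting on the world lets `other (other m)` reduce.
soundness (axC A) M w₁ rewrite not-involutive (value M w₁ A) = ⇒ᵇ-refl (value M w₁ A)
soundness (axC A) M w₂ rewrite not-involutive (value M w₂ A) = ⇒ᵇ-refl (value M w₂ A)
soundness (axA p) M w₁ rewrite not-involutive (value M w₂ (atom p)) = value-persistent M p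
soundness (axA p) M w₂ = refl
soundness axT M w₁ = refl
soundness axT M w₂ = refl
soundness (mp h k) M m = ⇒ᵇ-elim (soundness h M m) (soundness k M m)
soundness (rN h) M m = cong (λ b → not (not b)) (soundness h M (other m))

-- Completeness

Assignment : Set → Set
Assignment Atom = Formula Atom → Bool

-- The forced properties form a filter, so one can argue as if e satisfied every
-- theorem of SN, although only finitely many are used.
Forced : (Assignment Atom → Set) → Set
Forced {Atom} P = ∃[ φ ] (SN⊢ φ) × (∀ e → eval {Atom} e φ ≡ true → P e)

private variable
  P Q R : Assignment Atom → Set

∧ᵇ-split : ∀ {a b} → a ∧ᵇ b ≡ true → a ≡ true × b ≡ true
∧ᵇ-split {true} h = refl , h

⊢-conj : SN⊢ A → SN⊢ B → SN⊢ A ∧ B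
⊢-conj {A = A} {B} h k = mp (mp (taut λ e → pair (eval e A) (eval e B)) h) k
  where
  pair : ∀ a b → a ⇒ᵇ (b ⇒ᵇ (a ∧ᵇ b)) ≡ true
  pair true  b = ⇒ᵇ-refl b
  pair false b = refl

forced : SN⊢ A → Forced (λ e → eval e A ≡ true)
forced h = _ , h , λ e eq → eq

forced-map : (∀ e → P e → Q e) → Forced P → Forced Q
forced-map f (φ , h , k) = φ , h , λ e eq → f e (k e eq)

forced-map₂ : (∀ e → P e → Q e → R e) → Forced P → Forced Q → Forced R
forced-map₂ f (φ , h , k) (ψ , h′ , k′) = φ ∧ ψ , ⊢-conj h h′ , λ e eq →
  let (eq₁ , eq₂) = ∧ᵇ-split eq in f e (k e eq₁) (k′ e eq₂)

-- The theorem `φ` behind the forcing has `A` as a truth-table consequence, so `φ ⊃ A` is a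
-- tautology.
forced⁻¹ : Forced (λ e → eval e A ≡ true) → SN⊢ A
forced⁻¹ {A = A} (φ , h , k) = mp (taut λ e → impl (eval e φ) (eval e A) (k e)) h
  where
  impl : ∀ a b → (a ≡ true → b ≡ true) → a ⇒ᵇ b ≡ true
  impl true  b f = f refl
  impl false b f = refl

forced-⟺ : SN⊢ A ⟺ B → Forced (λ e → eval e A ≡ eval e B)
forced-⟺ h = forced-map (λ e → ⇔ᵇ-sound _ _) (forced h)

-- Laws for `N` over each connective

N-∧ : ∀ (A B : Formula Atom) → Forced (λ e → e (N (A ∧ B)) ≡ e (N A) ∨ᵇ e (N B))
N-∧ A B = forced-⟺ (axK A B)

N-~ : ∀ (A : Formula Atom) → Forced (λ e → e (N (~ A)) ≡ not (e (N A)))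
N-~ A = forced-map (λ e → sym) (forced-⟺ (axF A))

N-t : Forced {Atom} (λ e → e (N t) ≡ e t)
N-t = forced-map (λ e → sym) (forced-⟺ axT)

N-theorem : SN⊢ A → Forced (λ e → e (N A) ≡ false)
N-theorem {A = A} h = forced-map₂ (λ e → not-≡) (N-~ A) (forced (rN h))

N-nand : ∀ (A B : Formula Atom) →
  Forced (λ e → e (N (~ (A ∧ B))) ≡ not (e (N A) ∨ᵇ e (N B)))
N-nand A B = forced-map₂ (λ e eq eq′ → trans eq (cong not eq′)) (N-~ (A ∧ B)) (N-∧ A B)

N-~∧~ : ∀ (A B : Formula Atom) →
  Forced (λ e → e (N (~ (A ∧ ~ B))) ≡ not (e (N A) ∨ᵇ not (e (N B))))
N-~∧~ A B = forced-map₂ (λ e eq eq′ → trans eq (cong (λ b → not (e (N A) ∨ᵇ b)) eq′))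
  (N-nand A (~ B)) (N-~ B)

⇒ᵇ-nand : ∀ a b → a ⇒ᵇ b ≡ not (a ∧ᵇ not b)
⇒ᵇ-nand true  b = sym (not-involutive b)
⇒ᵇ-nand false b = refl

-- No axiom decomposes N (A ⊃ B), so A ⊃ B is used in the form ~ (A ∧ ~ B).
N-antitone : SN⊢ A ⊃ B → Forced (λ e → e (N B) ⇒ᵇ e (N A) ≡ true)
N-antitone {A = A} {B} h = forced-map₂
  (λ e eq eq′ → reorder (e (N A)) (e (N B)) (trans (sym eq) eq′))
  (N-~∧~ A B)
  (N-theorem (forced⁻¹ (forced-map
    (λ e → trans (sym (⇒ᵇ-nand (eval e A) (eval e B)))) (forced h))))
  where
  reorder : ∀ a b → not (a ∨ᵇ not b) ≡ false → b ⇒ᵇ a ≡ true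
  reorder true  true  _ = refl
  reorder true  false _ = refl
  reorder false false _ = refl

-- An assignment sees `N A` and `N B` as unrelated letters; antitonicity in both directions ties
-- them together.
N-cong : SN⊢ A ⟺ B → Forced (λ e → e (N A) ≡ e (N B))
N-cong h = forced-map₂ (λ e → ⇒ᵇ-antisym _ _)
  (N-antitone (forced⁻¹ (forced-map (λ e eq → proj₂ (∧ᵇ-split eq)) (forced h))))
  (N-antitone (forced⁻¹ (forced-map (λ e eq → proj₁ (∧ᵇ-split eq)) (forced h))))

taut-⟺ : (∀ e → eval e A ≡ eval e B) → SN⊢ A ⟺ B
taut-⟺ h = taut λ e → ⇔ᵇ-complete (h e)

N-⊃ : ∀ (A B : Formula Atom) →
  Forced (λ e → e (N (A ⊃ B)) ≡ not (e (N A) ∨ᵇ not (e (N B))))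
N-⊃ A B = forced-map₂ (λ e → trans)
  (N-cong (taut-⟺ λ e → ⇒ᵇ-nand (eval e A) (eval e B))) (N-~∧~ A B)

N-∨ : ∀ (A B : Formula Atom) →
  Forced (λ e → e (N (A ∨ B)) ≡ e (N A) ∧ᵇ e (N B))
N-∨ A B = forced-map₂ (λ e eq eq′ → trans (trans eq eq′) (as-∧ (e (N A)) (e (N B))))
  -- `A ∨ B` is replaced by `~ A ⊃ B`, so that `N-⊃` applies.
  (N-cong (taut-⟺ λ e → as-⇒ (eval e A) (eval e B)))
  (forced-map₂ (λ e eq eq′ → trans eq (cong (λ b → not (b ∨ᵇ not (e (N B)))) eq′))
    (N-⊃ (~ A) B) (N-~ A))
  where
  as-⇒ : ∀ a b → a ∨ᵇ b ≡ not a ⇒ᵇ b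
  as-⇒ a b = cong (_∨ᵇ b) (sym (not-involutive a))

  as-∧ : ∀ a b → not (not a ∨ᵇ not b) ≡ a ∧ᵇ b
  as-∧ true  b = not-involutive b
  as-∧ false b = refl

N-⊤ : Forced {Atom} (λ e → e (N ⊤′) ≡ false)
N-⊤ = N-theorem (taut λ e → refl)

N-⊥ : Forced {Atom} (λ e → e (N ⊥′) ≡ true)
N-⊥ = forced-map₂ (λ e → not-≡) (N-~ ⊥′) (N-theorem (taut λ e → refl))

-- (C) for ~ A gives ~ A ⊃ NN ~ A, and N commutes with ~, so the converse of (C) follows.
N-N : ∀ (A : Formula Atom) → Forced (λ e → e (N (N A)) ≡ eval e A)
N-N A = forced-map₂ (λ e eq h → antisym (eval e A) (e (N (N A))) eq (proj₁ h) (proj₂ h))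
  -- Negation moves outward twice: from `N (N (~ A))` to `N (~ N A)`, then to the negation of
  -- `N (N A)`.
  (forced-map₂ (λ e → trans) (N-cong (N~-⟺ A)) (N-~ (N A)))
  (forced-map₂ (λ e → _,_) (forced (axC A)) (forced (axC (~ A))))
  where
  N~-⟺ : ∀ A → SN⊢ N (~ A) ⟺ ~ N A
  N~-⟺ A = forced⁻¹ (forced-map (λ e → ⇔ᵇ-complete) (N-~ A))

  antisym : ∀ a b {c} → c ≡ not b → a ⇒ᵇ b ≡ true → not a ⇒ᵇ c ≡ true → b ≡ a
  antisym true  true  _    _ _ = refl
  antisym false false _    _ _ = refl
  antisym false true  refl _ ()

-- `s` says whether the current world is 1; `a` and `b` are the values of an atom at the current and
-- at the other world.
persistentᵇ : Bool → Bool → Bool → Bool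
persistentᵇ s a b = if s then a ⇒ᵇ b else b ⇒ᵇ a

-- At world 1 this is (A). At world 2 it is the image of (A) under rule (N).
N-atom : ∀ (p : Atom) →
  Forced (λ e → persistentᵇ (e t) (e (atom p)) (not (e (N (atom p)))) ≡ true)
N-atom {Atom} p = forced-map₂ (λ e → combine (e t) (e (atom p)) (e (N (atom p))))
  (forced-map₂ (λ e eq h → trans (cong (λ b → e t ⇒ᵇ (e (atom p) ⇒ᵇ b)) (sym eq)) h)
    (N-~ (atom p)) (forced (axA p)))
  (forced-map₂ (λ e eq eq′ → trans (sym eq) eq′) at-other (N-theorem (axA p)))
  where
  consequent : Forced {Atom} (λ e →
    e (N (atom p ⊃ N (~ atom p))) ≡ not (e (N (atom p)) ∨ᵇ not (not (e (atom p)))))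
  consequent = forced-map₂ (λ e eq eq′ → trans eq (cong (λ b → not (e (N (atom p)) ∨ᵇ not b)) eq′))
    (N-⊃ (atom p) (N (~ atom p))) (N-N (~ atom p))

  at-other : Forced {Atom} (λ e →
    e (N (t ⊃ (atom p ⊃ N (~ atom p))))
      ≡ not (e t ∨ᵇ not (not (e (N (atom p)) ∨ᵇ not (not (e (atom p)))))))
  at-other = forced-map₂ (λ e eq h → trans eq (cong₂ (λ a b → not (a ∨ᵇ not b)) (proj₁ h) (proj₂ h)))
    (N-⊃ t (atom p ⊃ N (~ atom p))) (forced-map₂ (λ e → _,_) N-t consequent)

  -- For `s` false the second hypothesis amounts to `c ∨ᵇ a`, that is, `not c ⇒ᵇ a`: persistence
  -- from the other world to this one.
  combine : ∀ s a c → s ⇒ᵇ (a ⇒ᵇ not c) ≡ true →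
    not (s ∨ᵇ not (not (c ∨ᵇ not (not a)))) ≡ false → persistentᵇ s a (not c) ≡ true
  combine true  a     c     h _ = h
  combine false true  true  _ _ = refl
  combine false true  false _ _ = refl
  combine false false true  _ _ = refl

-- The two-world model of an assignment

world : Bool → World
world s = if s then w₁ else w₂

-- The joins enforce persistence; they change nothing when persistentᵇ s a b holds.
extension : Bool → Bool → Bool → Subset 2
extension true  a b = a ∷ (a ∨ᵇ b) ∷ []
extension false a b = b ∷ (b ∨ᵇ a) ∷ []

extension-persistent : ∀ s a b → w₁ ∈ extension s a b → w₂ ∈ extension s a b
extension-persistent true  true b    here = there here
extension-persistent false a    true here = there here

does-extension : ∀ s a b → persistentᵇ s a b ≡ true →
  (a ≡ does (world s ∈? extension s a b)) × (b ≡ does (other (world s) ∈? extension s a b))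
does-extension true  true  true  _ = refl , refl
does-extension true  false true  _ = refl , refl
does-extension true  false false _ = refl , refl
does-extension false true  true  _ = refl , refl
does-extension false true  false _ = refl , refl
does-extension false false false _ = refl , refl

model : Assignment Atom → Model Atom
model e = record
  { v          = λ p → extension (e t) (e (atom p)) (not (e (N (atom p))))
  ; persistent = λ p → extension-persistent (e t) (e (atom p)) (not (e (N (atom p))))
  }

currently elsewhere : Assignment Atom → Formula Atom → Bool
currently e = value (model e) (world (e t))
elsewhere e = value (model e) (other (world (e t)))

-- e (N A) is compared along with e A because the clause for N A needs A at the other world.
Faithful : Formula Atom → Assignment Atom → Set
Faithful A e =
  (eval e A ≡ currently e A) × (e (N A) ≡ not (elsewhere e A))

does-world : ∀ s → (s ≡ does (world s ≟ w₁)) × (s ≡ not (does (other (world s) ≟ w₁)))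
does-world true  = refl , refl
does-world false = refl , refl

other-involutive : ∀ m → other (other m) ≡ m
other-involutive w₁ = refl
other-involutive w₂ = refl

-- Induction on `A`: the truth tables give the first component, and the law of `N` for the outermost
-- connective gives the second.
forced-faithful : ∀ (A : Formula Atom) → Forced (Faithful A)
forced-faithful (atom p) = forced-map
  (λ e h → let (eq , eq′) = does-extension (e t) (e (atom p)) (not (e (N (atom p)))) h in
    eq , trans (sym (not-involutive _)) (cong not eq′))
  (N-atom p)
forced-faithful ⊤′ = forced-map (λ e eq → refl , eq) N-⊤
forced-faithful ⊥′ = forced-map (λ e eq → refl , eq) N-⊥
forced-faithful t = forced-map
  (λ e eq → let (h , h′) = does-world (e t) in h , trans eq h′) N-t
forced-faithful (~ A) = forced-map₂
  (λ e eq (h , h′) → cong not h , trans eq (cong not h′)) (N-~ A) (forced-faithful A)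
forced-faithful (A ∧ B) = forced-map₂
  (λ e eq ((h , h′) , (k , k′)) →
    cong₂ _∧ᵇ_ h k , trans eq (trans (cong₂ _∨ᵇ_ h′ k′) (sym (not-∧ (elsewhere e A) _))))
  (N-∧ A B) (forced-map₂ (λ e → _,_) (forced-faithful A) (forced-faithful B))
forced-faithful (A ∨ B) = forced-map₂
  (λ e eq ((h , h′) , (k , k′)) →
    cong₂ _∨ᵇ_ h k , trans eq (trans (cong₂ _∧ᵇ_ h′ k′) (sym (not-∨ (elsewhere e A) _))))
  (N-∨ A B) (forced-map₂ (λ e → _,_) (forced-faithful A) (forced-faithful B))
forced-faithful (A ⊃ B) = forced-map₂
  (λ e eq ((h , h′) , (k , k′)) →
    cong₂ _⇒ᵇ_ h k ,
    trans eq (cong not (cong₂ _∨ᵇ_ h′ (trans (cong not k′) (not-involutive _)))))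
  (N-⊃ A B) (forced-map₂ (λ e → _,_) (forced-faithful A) (forced-faithful B))
forced-faithful (N A) = forced-map₂
  -- The two components trade places: `h′` is already the claim for `N A` here, and `N-N` with two
  -- crossings returns to `h`.
  (λ e eq (h , h′) → h′ , trans eq (trans h (trans
    (cong (λ m → value (model e) m A) (sym (other-involutive (world (e t)))))
    (sym (not-involutive _)))))
  (N-N A) (forced-faithful A)

-- Validity is used only at the current world of `model e`, where truth of `A` agrees with
-- `eval e A`.
completeness : ∀ (A : Formula Atom) → (∀ M m → value M m A ≡ true) → SN⊢ A
completeness A valid = forced⁻¹ (forced-map
  (λ e (h , _) → trans h (valid (model e) (world (e t)))) (forced-faithful A))

does⁻ : {X : Set} (X? : Dec X) → does X? ≡ true → X
does⁻ (yes x) _ = x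

theorem34 : {Atom : Set} → DecidableEquality Atom → (A : Formula Atom) →
    (∀ (M : Model Atom) → (M , w₁ ⊨ A) × (M , w₂ ⊨ A)) ⇔ (SN⊢ A)
theorem34 _ A = mk⇔
  (λ valid → completeness A λ where
    M w₁ → dec-true (sat? M w₁ A) (proj₁ (valid M))
    M w₂ → dec-true (sat? M w₂ A) (proj₂ (valid M)))
  (λ ⊢A M → holds ⊢A M w₁ , holds ⊢A M w₂)
  where
  holds : SN⊢ A → ∀ M m → M , m ⊨ A
  holds ⊢A M m = does⁻ (sat? M m A) (soundness ⊢A M m)
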